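{- Let $E=(U,C)$ be an instance of 3SAT, let $D$ be the clausal partition of $C$, and let $G=(V,\beta)$ be the instance graph of $E$. At the steady state attained by Part A of the algorithm, for every $d\in D$ the set of admissible assignments of $d$ contains every assignment $q:\mathrm{varset}(d)\to\{T,F\}$ that is the restriction to $\mathrm{varset}(d)$ of at least one assignment $s:U\to\{T,F\}$ satisfying $E$. Consequently the steady state contains all assignments satisfying $E$, i.e. for every assignment $s$ satisfying $E$ and every $d\in D$, the restriction $s|_{\mathrm{varset}(d)}$ is admissible in $d$ at steady state.
   Context: An instance of 3SAT is $E=(U,C)$ with $U$ a finite set of variables taking values in $\{T,F\}$ and $C$ a finite set of disjunctive clauses $\omega_1\vee\omega_2\vee\omega_3$, each $\omega_i$ being $u$ or $\neg u$ for some $u\in U$ (variables may repeat within a clause); $E$ denotes the conjunction of all clauses of $C$. An assignment $s:U\to\{T,F\}$ satisfies $E$ if all clauses of $C$ evaluate to $T$. $\mathrm{varset}(c)$ is the set of variables occurring in the clause $c$. Clausal partition $D$ of $C$: the partition of $C$ in which two clauses lie in the same element iff they have the same set of variables (ignoring negation). For $d\in D$, $\mathrm{varset}(d)$ is this common set of variables (at most 3 variables). Instance graph $G=(V,\beta)$: $V$ is in bijection with $D$ (identify vertices with elements of $D$), and $\{d_i,d_j\}\in\beta$ iff $d_i\ne d_j$ and $0<|\mathrm{varset}(d_i)\cap\mathrm{varset}(d_j)|<3$. Each $d\in D$ carries a constraint set $R(d)\subseteq\{T,F\}^{\mathrm{varset}(d)}$ of excluded assignments; the assignments not in $R(d)$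 are the admissible assignments of $d$. Implication operator $d_i\nabla d_j$ (defined when $W=\mathrm{varset}(d_i)\cap\mathrm{varset}(d_j)\neq\emptyset$): an assignment $w:W\to\{T,F\}$ is inadmissible in $d_i$ if every extension of $w$ to $\mathrm{varset}(d_i)$ belongs to $R(d_i)$; the operator adds to $R(d_j)$ every assignment to $\mathrm{varset}(d_j)$ whose restriction to $W$ is inadmissible in $d_i$, and changes nothing else. Part A of the algorithm: initially $R(d)$ is the set of assignments to $\mathrm{varset}(d)$ that fail at least one clause of $d$, for each $d\in D$. Then repeat the following pass: for every $d_i\in D$ and every $d_j$ adjacent to $d_i$ in $G$, apply $d_i\nabla d_j$. Stop when a pass changes no constraint set; the resulting family $(R(d))_{d\in D}$ is the steady state. -}

module Defs where

open import Data.Bool using (Bool; true; false; not; _∨_)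
import Data.Bool.Properties as Bool
open import Data.Empty using (⊥-elim)
open import Data.Fin using (Fin; zero; suc)
import Data.Fin.Properties as Fin
open import Data.Fin.Subset
  using (Subset; inside; outside; _∈_; _⊆_; _∩_; _∪_; ⁅_⁆; ⋃; ∣_∣)
open import Data.Fin.Subset.Properties
  using (_∈?_; p∩q⊆p; p∩q⊆q; ∪-idem; ∪-identityʳ)
open import Data.List
  using (List; []; _∷_; _++_; map; concatMap; filter; deduplicate; length;
         lookup; foldl; allFin; cartesianProduct)
open import Data.List.Membership.Propositional renaming (_∈_ to _∈ₗ_) using ()
open import Data.List.Membership.Propositional.Properties
  using (∈-map⁺; ∈-map⁻; ∈-++⁺ˡ; ∈-++⁺ʳ; ∈-concatMap⁺; ∈-filter⁺; ∈-filter⁻;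
         ∈-lookup; ∈-allFin)
open import Data.List.Relation.Binary.Permutation.Propositional using (_↭_; ↭-refl)
open import Data.List.Relation.Unary.All as All using (All; []; _∷_)
import Data.List.Relation.Unary.All.Properties as All
open import Data.List.Relation.Unary.AllPairs using (AllPairs; []; _∷_)
import Data.List.Relation.Unary.AllPairs.Properties as AllPairs
open import Data.List.Relation.Unary.Any as Any using (Any; here; there; any?)
import Data.List.Relation.Unary.Any.Properties as Any
open import Data.Nat using (ℕ; suc; _+_; _<_; _≤_; _<?_; z≤n; s≤s)
open import Data.Nat.Induction using (<-wellFounded)
import Data.Nat.Properties as ℕ
open import Data.Product using (Σ; Σ-syntax; ∃-syntax; _×_; _,_; proj₁; proj₂)
open import Data.Vec as Vec using (Vec; []; _∷_; here; there)
open import Data.Vec.Relation.Unary.All using (all?) renaming (All to Allᵥ)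
import Data.Vec.Properties as Vec
open import Induction.WellFounded using (Acc; acc)
open import Relation.Binary.PropositionalEquality
  using (_≡_; _≢_; refl; sym; trans; cong; cong₂; subst)
open import Relation.Binary.Definitions using (DecidableEquality)
open import Relation.Nullary
  using (¬_; Dec; yes; no; ⌊_⌋; _×-dec_; ¬?; _→-dec_; contradiction)
open import Relation.Nullary.Decidable using (map′)

private
  variable
    n : ℕ
    V W : Subset n

data Literal (n : ℕ) : Set where
  pos neg : Fin n → Literal n

var : Literal n → Fin n
var (pos u) = u
var (neg u) = u

evalLiteral : Literal n → Bool → Bool
evalLiteral (pos _) b = b
evalLiteral (neg _) b = not b

Clause : ℕ → Set
Clause n = Vec (Literal n) 3

evalClause : (Fin n → Bool) → Clause n → Bool
evalClause s (ω₁ ∷ ω₂ ∷ ω₃ ∷ []) = ⟦ ω₁ ⟧ ∨ ⟦ ω₂ ⟧ ∨ ⟦ ω₃ ⟧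
  where
  ⟦_⟧ : Literal _ → Bool
  ⟦ ω ⟧ = evalLiteral ω (s (var ω))

varsetᶜ : Clause n → Subset n
varsetᶜ (ω₁ ∷ ω₂ ∷ ω₃ ∷ []) = ⁅ var ω₁ ⁆ ∪ ⁅ var ω₂ ⁆ ∪ ⁅ var ω₃ ⁆

-- U is Fin numVars; the finite set C is given by any list of its elements.
record Instance : Set where
  field
    numVars : ℕ
    clauses : List (Clause numVars)

open Instance public

Satisfies : (E : Instance) → (Fin (numVars E) → Bool) → Set
Satisfies E s = All (λ c → evalClause s c ≡ true) (clauses E)

-- A first-order presentation of the functions W → {T,F}, so that equal
-- functions are propositionally equal; `value` and `tabulate` convert.
data Assignment : Subset n → Set where
  []   : Assignment []
  _∷_  : Bool → Assignment W → Assignment (inside ∷ W)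
  skip : Assignment W → Assignment (outside ∷ W)

value : ∀ {x} → Assignment W → x ∈ W → Bool
value (b ∷ q)  here        = b
value (_ ∷ q)  (there x∈W) = value q x∈W
value (skip q) (there x∈W) = value q x∈W

tabulate : (∀ {x} → x ∈ W → Bool) → Assignment W
tabulate {W = []}          f = []
tabulate {W = inside  ∷ _} f = f here ∷ tabulate (λ x∈W → f (there x∈W))
tabulate {W = outside ∷ _} f = skip (tabulate (λ x∈W → f (there x∈W)))

value-tabulate : ∀ {x} (f : ∀ {x} → x ∈ W → Bool) (x∈W : x ∈ W) →
                 value (tabulate f) x∈W ≡ f x∈W
value-tabulate {W = inside  ∷ _} f here        = refl
value-tabulate {W = inside  ∷ _} f (there x∈W) = value-tabulate (λ y → f (there y)) x∈W
value-tabulate {W = outside ∷ _} f (there x∈W) = value-tabulate (λ y → f (there y)) x∈W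

tabulate-value : (q : Assignment W) → tabulate (value q) ≡ q
tabulate-value []       = refl
tabulate-value (b ∷ q)  = cong (b ∷_) (tabulate-value q)
tabulate-value (skip q) = cong skip (tabulate-value q)

restrict : W ⊆ V → Assignment V → Assignment W
restrict W⊆V q = tabulate (λ x∈W → value q (W⊆V x∈W))

infix 6 _↾_
_↾_ : (Fin n → Bool) → (W : Subset n) → Assignment W
s ↾ W = tabulate (λ {x} _ → s x)

infix 4 _≟_
_≟_ : DecidableEquality (Assignment W)
[]     ≟ []      = yes refl
skip p ≟ skip q  = map′ (cong skip) (λ { refl → refl }) (p ≟ q)
(a ∷ p) ≟ (b ∷ q) =
  map′ (λ { (refl , refl) → refl }) (λ { refl → refl , refl }) (a Bool.≟ b ×-dec p ≟ q)

assignments : (W : Subset n) → List (Assignment W)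
assignments []            = [] ∷ []
assignments (inside  ∷ W) = map (true ∷_) (assignments W) ++ map (false ∷_) (assignments W)
assignments (outside ∷ W) = map skip (assignments W)

∈-assignments : (q : Assignment W) → q ∈ₗ assignments W
∈-assignments []          = here refl
∈-assignments (true ∷ q)  = ∈-++⁺ˡ (∈-map⁺ (true ∷_) (∈-assignments q))
∈-assignments (false ∷ q) =
  ∈-++⁺ʳ (map (true ∷_) (assignments _)) (∈-map⁺ (false ∷_) (∈-assignments q))
∈-assignments (skip q)    = ∈-map⁺ skip (∈-assignments q)

∀assignment? : {P : Assignment W → Set} → (∀ q → Dec (P q)) → Dec (∀ q → P q)
∀assignment? {W = W} P? =
  map′ (λ ps q → All.lookup ps (∈-assignments q)) (λ f → All.tabulate (λ {q} _ → f q))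
       (All.all? P? (assignments W))

-- A literal whose variable lies outside W is not falsified; for a clause c of
-- d and W = varset d this case does not arise (see varset-common below).
Falsifies : {W : Subset n} → Assignment W → Literal n → Set
Falsifies {W = W} q ω = Σ[ x∈W ∈ var ω ∈ W ] evalLiteral ω (value q x∈W) ≡ false

∈-irrelevant : {W : Subset n} {x : Fin n} (p q : x ∈ W) → p ≡ q
∈-irrelevant here      here      = refl
∈-irrelevant (there p) (there q) = cong there (∈-irrelevant p q)

falsifies? : {W : Subset n} (q : Assignment W) (ω : Literal n) → Dec (Falsifies q ω)
falsifies? {W = W} q ω with var ω ∈? W
... | no  x∉W = no (λ f → x∉W (proj₁ f))
... | yes x∈W =
  map′ (x∈W ,_)
       (λ (y∈W , e) → subst (λ z → evalLiteral ω (value q z) ≡ false) (∈-irrelevant y∈W x∈W) e)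
       (evalLiteral ω (value q x∈W) Bool.≟ false)

Fails : {W : Subset n} → Assignment W → Clause n → Set
Fails q c = Allᵥ (Falsifies q) c

fails? : {W : Subset n} (q : Assignment W) (c : Clause n) → Dec (Fails q c)
fails? q = all? (falsifies? q)

SameVars : Clause n → Clause n → Set
SameVars c c′ = varsetᶜ c ≡ varsetᶜ c′

sameVars? : (c c′ : Clause n) → Dec (SameVars c c′)
sameVars? c c′ = Vec.≡-dec Bool._≟_ (varsetᶜ c) (varsetᶜ c′)

module _ (E : Instance) where

  private
    C = clauses E

    representatives : List (Clause (numVars E))
    representatives = deduplicate sameVars? C

    class : Clause (numVars E) → List (Clause (numVars E))
    class c = filter (sameVars? c) C

  clausalPartition : List (List (Clause (numVars E)))
  clausalPartition = map class representatives

  -- Elements d of the clausal partition, equivalently vertices of G.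
  Cell : Set
  Cell = Fin (length clausalPartition)

  cellClauses : Cell → List (Clause (numVars E))
  cellClauses d = lookup clausalPartition d

  varset : Cell → Subset (numVars E)
  varset d = ⋃ (map varsetᶜ (cellClauses d))

  -- The cells partition C by variable set, and varset d is the common
  -- variable set of the clauses of d.

  private
    cell-class : ∀ d → ∃[ r ] r ∈ₗ C × cellClauses d ≡ class r
    cell-class d with ∈-map⁻ class (∈-lookup {xs = clausalPartition} d)
    ... | r , r∈ , eq = r , Any.deduplicate⁻ sameVars? r∈ , eq

    ⋃-const : ∀ {m} {X : Subset m} (xs : List (Subset m)) → All (_≡ X) xs →
              ∀ {x} → x ∈ₗ xs → ⋃ xs ≡ X
    ⋃-const (x ∷ [])     (refl ∷ [])       _ = ∪-identityʳ _
    ⋃-const (x ∷ y ∷ ys) (refl ∷ eq ∷ eqs) _ =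
      trans (cong (x ∪_) (⋃-const (y ∷ ys) (eq ∷ eqs) (here refl))) (∪-idem _)

    lookup-pairs : ∀ {A : Set} {R : A → A → Set} → (∀ {x y} → R x y → R y x) →
                   ∀ {xs} → AllPairs R xs → ∀ {i j} → i ≢ j → R (lookup xs i) (lookup xs j)
    lookup-pairs sy (_  ∷ _)  {zero}  {zero}  i≢j = contradiction refl i≢j
    lookup-pairs sy (rs ∷ _)  {zero}  {suc j} i≢j = All.lookup rs (∈-lookup j)
    lookup-pairs sy (rs ∷ _)  {suc i} {zero}  i≢j = sy (All.lookup rs (∈-lookup i))
    lookup-pairs sy (_  ∷ ps) {suc i} {suc j} i≢j = lookup-pairs sy ps (λ e → i≢j (cong suc e))

    deduplicate-distinct : (xs : List (Clause (numVars E))) →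
                           AllPairs (λ c c′ → ¬ SameVars c c′) (deduplicate sameVars? xs)
    deduplicate-distinct []       = []
    deduplicate-distinct (x ∷ xs) =
      All.all-filter (λ y → ¬? (sameVars? x y)) (deduplicate sameVars? xs)
      ∷ AllPairs.filter⁺ (λ y → ¬? (sameVars? x y)) (deduplicate-distinct xs)

    Apart : List (Clause (numVars E)) → List (Clause (numVars E)) → Set
    Apart cs cs′ = ∀ c c′ → c ∈ₗ cs → c′ ∈ₗ cs′ → ¬ SameVars c c′

    class-apart : ∀ {x y} → ¬ SameVars x y → Apart (class x) (class y)
    class-apart {x} {y} x≁y c c′ c∈ c′∈ c∼c′ =
      x≁y (trans (proj₂ (∈-filter⁻ (sameVars? x) {xs = C} c∈))
          (trans c∼c′ (sym (proj₂ (∈-filter⁻ (sameVars? y) {xs = C} c′∈)))))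

    cells-apart : AllPairs Apart clausalPartition
    cells-apart = AllPairs.map⁺ (go (deduplicate-distinct C))
      where
      go : ∀ {xs : List (Clause (numVars E))} → AllPairs (λ c c′ → ¬ SameVars c c′) xs →
           AllPairs (λ x y → Apart (class x) (class y)) xs
      go []         = []
      go {x ∷ _} (ds ∷ dss) = All.map (λ {y} → class-apart {x} {y}) ds ∷ go dss

  cellClauses⊆C : ∀ d {c} → c ∈ₗ cellClauses d → c ∈ₗ clauses E
  cellClauses⊆C d c∈d with cell-class d
  ... | r , _ , eq = proj₁ (∈-filter⁻ (sameVars? r) (subst (_ ∈ₗ_) eq c∈d))

  cell-nonempty : ∀ d → ∃[ c ] c ∈ₗ cellClauses d
  cell-nonempty d with cell-class d
  ... | r , r∈C , eq = r , subst (r ∈ₗ_) (sym eq) (∈-filter⁺ (sameVars? r) r∈C refl)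

  cell-covers : ∀ {c} → c ∈ₗ clauses E → ∃[ d ] c ∈ₗ cellClauses d
  cell-covers {c} c∈C = Any.index c∈cell , Any.lookup-index c∈cell
    where
    c∈cell : Any (c ∈ₗ_) clausalPartition
    c∈cell = Any.map⁺ (Any.map (λ {r} r∼c → ∈-filter⁺ (sameVars? r) c∈C r∼c)
               (Any.deduplicate⁺ sameVars? trans same))
      where
      same : Any (λ r → SameVars r c) C
      same = Any.map (λ { refl → refl }) c∈C

  cell-sameVars : ∀ d {c c′} → c ∈ₗ cellClauses d → c′ ∈ₗ cellClauses d → SameVars c c′
  cell-sameVars d c∈d c′∈d with cell-class d
  ... | r , _ , eq = trans (sym (proj₂ (∈-filter⁻ (sameVars? r) {xs = C} (subst (_ ∈ₗ_) eq c∈d))))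
                           (proj₂ (∈-filter⁻ (sameVars? r) {xs = C} (subst (_ ∈ₗ_) eq c′∈d)))

  sameVars-cell : ∀ {d d′ c c′} → c ∈ₗ cellClauses d → c′ ∈ₗ cellClauses d′ →
                  SameVars c c′ → d ≡ d′
  sameVars-cell {d} {d′} c∈d c′∈d′ c∼c′ with d Fin.≟ d′
  ... | yes d≡d′ = d≡d′
  ... | no  d≢d′ = ⊥-elim
    (lookup-pairs (λ ap c c′ c∈ c′∈ e → ap c′ c c′∈ c∈ (sym e)) cells-apart d≢d′ _ _ c∈d c′∈d′ c∼c′)

  varset-common : ∀ d {c} → c ∈ₗ cellClauses d → varset d ≡ varsetᶜ c
  varset-common d c∈d =
    ⋃-const _ (All.map⁺ (All.tabulate (λ c′∈d → cell-sameVars d c′∈d c∈d))) (∈-map⁺ varsetᶜ c∈d)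

  Adjacent : Cell → Cell → Set
  Adjacent dᵢ dⱼ = dᵢ ≢ dⱼ × 0 < ∣ varset dᵢ ∩ varset dⱼ ∣ × ∣ varset dᵢ ∩ varset dⱼ ∣ < 3

  adjacent? : ∀ dᵢ dⱼ → Dec (Adjacent dᵢ dⱼ)
  adjacent? dᵢ dⱼ = ¬? (dᵢ Fin.≟ dⱼ) ×-dec (0 <? _) ×-dec (_ <? 3)

  -- Each edge of G occurs in both orientations.
  adjacentPairs : List (Cell × Cell)
  adjacentPairs =
    filter (λ (dᵢ , dⱼ) → adjacent? dᵢ dⱼ)
           (cartesianProduct (allFin (length clausalPartition)) (allFin (length clausalPartition)))

  -- R d is the characteristic function of the set of excluded assignments.
  Constraints : Set
  Constraints = (d : Cell) → Assignment (varset d) → Bool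

  Excluded Admissible : Constraints → (d : Cell) → Assignment (varset d) → Set
  Excluded   R d q = R d q ≡ true
  Admissible R d q = ¬ Excluded R d q

  Inadmissible : Constraints → (d : Cell) → W ⊆ varset d → Assignment W → Set
  Inadmissible R d W⊆d w = ∀ p → restrict W⊆d p ≡ w → Excluded R d p

  inadmissible? : ∀ R d (W⊆d : W ⊆ varset d) w → Dec (Inadmissible R d W⊆d w)
  inadmissible? R d W⊆d w =
    ∀assignment? (λ p → (restrict W⊆d p ≟ w) →-dec (R d p Bool.≟ true))

  Forbidden : Constraints → (dᵢ dⱼ : Cell) → Assignment (varset dⱼ) → Set
  Forbidden R dᵢ dⱼ q =
    Inadmissible R dᵢ (p∩q⊆p (varset dᵢ) (varset dⱼ))
                 (restrict (p∩q⊆q (varset dᵢ) (varset dⱼ)) q)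

  forbidden? : ∀ R dᵢ dⱼ q → Dec (Forbidden R dᵢ dⱼ q)
  forbidden? R dᵢ dⱼ q = inadmissible? R dᵢ (p∩q⊆p (varset dᵢ) (varset dⱼ)) _

  -- Part A applies dᵢ ∇ dⱼ only to adjacent cells, whose variable sets meet.
  _∇_ : Cell → Cell → Constraints → Constraints
  (dᵢ ∇ dⱼ) R d q with d Fin.≟ dⱼ
  ... | no  _    = R d q
  ... | yes refl = R d q ∨ ⌊ forbidden? R dᵢ d q ⌋

  initial : Constraints
  initial d q = ⌊ any? (fails? q) (cellClauses d) ⌋

  runPass : List (Cell × Cell) → Constraints → Constraints
  runPass ps R = foldl (λ S (dᵢ , dⱼ) → (dᵢ ∇ dⱼ) S) R ps

  Unchanged : Constraints → Constraints → Set
  Unchanged R R′ = ∀ d q → R′ d q ≡ R d q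

  -- A pass may process the adjacent pairs in any order.
  data PartA (R : Constraints) : Constraints → Set where
    stop     : ∀ {ps} → ps ↭ adjacentPairs → Unchanged R (runPass ps R) →
               PartA R (runPass ps R)
    continue : ∀ {ps S} → ps ↭ adjacentPairs → ¬ Unchanged R (runPass ps R) →
               PartA (runPass ps R) S → PartA R S

  SteadyState : Constraints → Set
  SteadyState S = PartA initial S

  -- Termination: the number of admissible assignments drops in every pass but
  -- the last.

  private
    Slot : Set
    Slot = Σ Cell (λ d → Assignment (varset d))

    slots : List Slot
    slots = concatMap (λ d → map (d ,_) (assignments (varset d))) (allFin _)

    ∈-slots : ∀ d q → (d , q) ∈ₗ slots
    ∈-slots d q = ∈-concatMap⁺ (λ d → map (d ,_) (assignments (varset d)))
      (Any.map (λ { refl → ∈-map⁺ (d ,_) (∈-assignments q) }) (∈-allFin d))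

    weight : Bool → ℕ
    weight true  = 0
    weight false = 1

    count : List Slot → Constraints → ℕ
    count []             R = 0
    count ((d , q) ∷ xs) R = weight (R d q) + count xs R

    _≼_ : Constraints → Constraints → Set
    R ≼ R′ = ∀ d q → R d q ≡ true → R′ d q ≡ true

    ∇-grows : ∀ dᵢ dⱼ R → R ≼ (dᵢ ∇ dⱼ) R
    ∇-grows dᵢ dⱼ R d q e with d Fin.≟ dⱼ
    ... | no  _    = e
    ... | yes refl rewrite e = refl

    pass-grows : ∀ ps R → R ≼ runPass ps R
    pass-grows []               R d q e = e
    pass-grows ((dᵢ , dⱼ) ∷ ps) R d q e =
      pass-grows ps ((dᵢ ∇ dⱼ) R) d q (∇-grows dᵢ dⱼ R d q e)

    weight-≤ : ∀ {a b} → (a ≡ true → b ≡ true) → weight b ≤ weight a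
    weight-≤ {false} {false} f = ℕ.≤-refl
    weight-≤ {false} {true}  f = z≤n
    weight-≤ {true}          f rewrite f refl = z≤n

    weight-< : ∀ {a b} → (a ≡ true → b ≡ true) → b ≢ a → weight b < weight a
    weight-< {false} {false} f b≢a = contradiction refl b≢a
    weight-< {false} {true}  f b≢a = s≤s z≤n
    weight-< {true}          f b≢a = contradiction (f refl) b≢a

    count-≤ : ∀ xs {R R′} → R ≼ R′ → count xs R′ ≤ count xs R
    count-≤ []             le = z≤n
    count-≤ ((d , q) ∷ xs) le = ℕ.+-mono-≤ (weight-≤ (le d q)) (count-≤ xs le)

    count-< : ∀ {xs R R′} → R ≼ R′ → Any (λ (d , q) → R′ d q ≢ R d q) xs →
              count xs R′ < count xs R
    count-< {xs = (d , q) ∷ xs} le (here ne) =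
      ℕ.+-mono-<-≤ (weight-< (le d q) ne) (count-≤ xs le)
    count-< {xs = (d , q) ∷ xs} le (there a) =
      ℕ.+-mono-≤-< (weight-≤ (le d q)) (count-< le a)

    terminates : ∀ R → Acc _<_ (count slots R) → ∃[ S ] PartA R S
    terminates R (acc rec)
      with All.all? (λ (d , q) → runPass adjacentPairs R d q Bool.≟ R d q) slots
    ... | yes same = _ , stop ↭-refl (λ d q → All.lookup same (∈-slots d q))
    ... | no  diff
      with terminates (runPass adjacentPairs R)
             (rec (count-< (pass-grows adjacentPairs R) (All.¬All⇒Any¬ (λ _ → _ Bool.≟ _) _ diff)))
    ...   | S , run =
      S , continue ↭-refl (λ u → diff (All.tabulate (λ {(d , q)} _ → u d q))) run

  steadyState-exists : ∃[ S ] SteadyState S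
  steadyState-exists = terminates initial (<-wellFounded _)

{-# OPTIONS --safe #-}
-- Fix a satisfying assignment s. That no restriction of s is excluded is an
-- invariant of Part A: s falsifies no clause, and the restrictions of s to two
-- cells agree on the common variables, so the one on dᵢ is an admissible
-- extension which prevents dᵢ ∇ dⱼ from excluding the one on dⱼ.
module Submission where

open import Defs
open import Data.Bool using (Bool; true; false)
open import Data.Bool.Properties using (not-¬)
open import Data.Fin using (Fin)
import Data.Fin.Properties as Fin
open import Data.Fin.Subset using (Subset; inside; outside; _∈_; _⊆_)
open import Data.Fin.Subset.Properties using (p∩q⊆p; p∩q⊆q)
open import Data.List using ([]; _∷_)
open import Data.List.Membership.Propositional using (find)
import Data.List.Relation.Unary.All as All
open import Data.List.Relation.Unary.Any using (any?)
open import Data.Nat using (ℕ)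
open import Data.Product using (_×_; ∃-syntax; _,_)
open import Data.Vec using ([]; _∷_; here; there)
open import Data.Vec.Relation.Unary.All using ([]; _∷_)
open import Relation.Binary.PropositionalEquality
  using (_≡_; refl; sym; trans; cong; cong₂)
open import Relation.Nullary using (¬_; yes; no)

private
  variable
    n : ℕ
    V W : Subset n

-- Because `Assignment` is first-order data, induction on `W` turns pointwise agreement into
-- propositional equality.
tabulate-cong : {f g : ∀ {x} → x ∈ W → Bool} →
                (∀ {x} (x∈W : x ∈ W) → f x∈W ≡ g x∈W) → tabulate f ≡ tabulate g
tabulate-cong {W = []}          f≗g = refl
tabulate-cong {W = inside  ∷ _} f≗g =
  cong₂ _∷_ (f≗g here) (tabulate-cong (λ x∈W → f≗g (there x∈W)))
tabulate-cong {W = outside ∷ _} f≗g =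
  cong skip (tabulate-cong (λ x∈W → f≗g (there x∈W)))

value-↾ : (s : Fin n → Bool) {x : Fin n} (x∈W : x ∈ W) → value (s ↾ W) x∈W ≡ s x
value-↾ s = value-tabulate (λ {x} _ → s x)

-- Makes restrictions of `s` to two cells comparable: both restrict to the same assignment on the
-- common variables.
restrict-↾ : (s : Fin n → Bool) (W⊆V : W ⊆ V) → restrict W⊆V (s ↾ V) ≡ s ↾ W
restrict-↾ s W⊆V = tabulate-cong (λ x∈W → value-↾ s (W⊆V x∈W))

falsifies-↾ : (s : Fin n → Bool) (ω : Literal n) →
              Falsifies (s ↾ W) ω → evalLiteral ω (s (var ω)) ≡ false
falsifies-↾ s ω (x∈W , e) = trans (cong (evalLiteral ω) (sym (value-↾ s x∈W))) e

-- Each `Falsifies` includes a proof that the variable lies in `W`, where `s ↾ W` takes the values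
-- of `s`.
fails-↾ : (s : Fin n → Bool) (c : Clause n) → Fails (s ↾ W) c → evalClause s c ≡ false
fails-↾ s (ω₁ ∷ ω₂ ∷ ω₃ ∷ []) (f₁ ∷ f₂ ∷ f₃ ∷ [])
  rewrite falsifies-↾ s ω₁ f₁ | falsifies-↾ s ω₂ f₂ | falsifies-↾ s ω₃ f₃ = refl

module _ (E : Instance) (s : Fin (numVars E) → Bool) where

  Admits : Constraints E → Set
  Admits R = ∀ d → Admissible E R d (s ↾ varset E d)

  initial-admits : Satisfies E s → Admits (initial E)
  initial-admits sat d e with any? (fails? (s ↾ varset E d)) (cellClauses E d)
  initial-admits sat d () | no  _
  initial-admits sat d _  | yes failing with find failing
  ... | c , c∈d , fails =
    -- The failing clause `c` belongs to the instance, so it would be both true and false under `s`.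
    not-¬ (All.lookup sat (cellClauses⊆C E d c∈d)) (fails-↾ s c fails)

  admits⇒¬forbidden : ∀ {R} → Admits R → ∀ dᵢ dⱼ → ¬ Forbidden E R dᵢ dⱼ (s ↾ varset E dⱼ)
  -- The extension fed to `forb` is `s ↾ Vᵢ`; both sides of the required equation equal
  -- `s ↾ (Vᵢ ∩ Vⱼ)`.
  admits⇒¬forbidden adm dᵢ dⱼ forb = adm dᵢ (forb (s ↾ Vᵢ)
    (trans (restrict-↾ s (p∩q⊆p Vᵢ Vⱼ)) (sym (restrict-↾ s (p∩q⊆q Vᵢ Vⱼ)))))
    where
    Vᵢ = varset E dᵢ
    Vⱼ = varset E dⱼ

  ∇-admits : ∀ dᵢ dⱼ {R} → Admits R → Admits (_∇_ E dᵢ dⱼ R)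
  ∇-admits dᵢ dⱼ {R} adm d e with d Fin.≟ dⱼ
  ... | no  _    = adm d e
  -- At the target cell the new entry is a disjunction: `e` means exclusion already in `R`, recorded
  -- by `eq`, or a newly forbidden assignment.
  ... | yes refl with R d (s ↾ varset E d) in eq | forbidden? E R dᵢ d (s ↾ varset E d)
  ...   | true  | _        = adm d eq
  ...   | false | yes forb = admits⇒¬forbidden adm dᵢ d forb
  ∇-admits dᵢ dⱼ adm d () | yes refl | false | no _

  runPass-admits : ∀ ps {R} → Admits R → Admits (runPass E ps R)
  runPass-admits []               adm = adm
  runPass-admits ((dᵢ , dⱼ) ∷ ps) adm = runPass-admits ps (∇-admits dᵢ dⱼ adm)

  -- Induction on the run: in whatever order a pass takes the pairs, it is a sequence of `∇` steps,
  -- each keeping the invariant.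
  partA-admits : ∀ {R S} → PartA E R S → Admits R → Admits S
  partA-admits (stop     {ps} _ _)     adm = runPass-admits ps adm
  partA-admits (continue {ps} _ _ run) adm = partA-admits run (runPass-admits ps adm)

theorem2 : (E : Instance) (R : Constraints E) → SteadyState E R →
    ((d : Cell E) (q : Assignment (varset E d)) →
    (∃[ s ] Satisfies E s × s ↾ varset E d ≡ q) → Admissible E R d q)
    × ((s : Fin (numVars E) → Bool) → Satisfies E s →
    (d : Cell E) → Admissible E R d (s ↾ varset E d))
theorem2 E R steady = (λ { d _ (s , sat , refl) → admits s sat d }) , admits
  where
  admits : ∀ s → Satisfies E s → Admits E s R
  admits s sat = partA-admits E s steady (initial-admits E s sat)
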